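{- Let $R$ be a commutative ring and let $G$ be an edge-labeled graph over $R$. Then the ring of splines $R_G$ is isomorphic, as a ring, to the ring of limit splines of $G$, that is, to the limit in the category of commutative rings of the spline diagram $\mathfrak{G}$ associated to $G$.
   Context: An edge-labeled graph $G$ over $R$ is a finite graph $(V,E)$ with a map $\alpha$ from $E$ to the set of ideals of $R$; write $e_{uv}$ for an edge joining $u$ and $v$ and $I_{uv}=\alpha(e_{uv})$. A spline is a function $s:V\to R$ with $s(u)-s(v)\in\alpha(e_{uv})$ for every edge $e_{uv}\in E$. The set $R_G$ of all splines is a ring under pointwise operations. The spline diagram $\mathfrak{G}$ associated to $G$ is the diagram in the category of commutative rings having one object $R_u=R$ for each vertex $u\in V$, one object $R/I_{uv}$ for each edge $e_{uv}\in E$, and, for each edge $e_{uv}$, the quotient morphisms $R_u\to R/I_{uv}\leftarrow R_v$. Its limit is called the ring of limit splines. -}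

module Defs where

open import Algebra.Bundles using (CommutativeRing; RawRing)
import Algebra.Construct.Pointwise as Pointwise
open import Algebra.Morphism.Bundles using (RingHomomorphism)
import Algebra.Morphism.RingMonomorphism as RingMonomorphism
open import Algebra.Morphism.Structures
  using (IsRingMonomorphism; IsRingIsomorphism)
import Algebra.Properties.AbelianGroup as AbelianGroupProperties
import Algebra.Properties.CommutativeSemigroup as CommutativeSemigroupProperties
import Algebra.Properties.Ring as RingProperties
open import Data.Fin.Base using (Fin)
open import Data.Nat.Base using (ℕ)
open import Data.Product.Base using (Σ-syntax; _×_; _,_; proj₁; proj₂)
open import Level using (Level; _⊔_) renaming (suc to lsuc)
open import Relation.Binary.Core using (Rel)
open import Relation.Unary using (Pred; _∈_)
import Relation.Binary.Reasoning.Setoid as SetoidReasoning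

private
  variable
    a b c ℓ ℓ₁ ℓ₂ : Level

infix 4 _≅_

CRingHom : CommutativeRing a ℓ₁ → CommutativeRing b ℓ₂ → Set (a ⊔ b ⊔ ℓ₁ ⊔ ℓ₂)
CRingHom A B = RingHomomorphism (CommutativeRing.rawRing A) (CommutativeRing.rawRing B)

_≅_ : CommutativeRing a ℓ₁ → CommutativeRing b ℓ₂ → Set (a ⊔ b ⊔ ℓ₁ ⊔ ℓ₂)
A ≅ B = Σ[ f ∈ (CommutativeRing.Carrier A → CommutativeRing.Carrier B) ]
          IsRingIsomorphism (CommutativeRing.rawRing A) (CommutativeRing.rawRing B) f

-- Diagrams are indexed by a directed multigraph.  This is the same as a functor
-- from the free category on it, and cones over the two agree.
record Diagram (c ℓ : Level) : Set (lsuc (c ⊔ ℓ)) where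
  field
    Node  : Set
    Arrow : Node → Node → Set
    obj   : Node → CommutativeRing c ℓ
    mor   : ∀ {i j} → Arrow i j → CRingHom (obj i) (obj j)

record Cone (D : Diagram c ℓ) : Set (lsuc (c ⊔ ℓ)) where
  open Diagram D
  field
    apex : CommutativeRing c ℓ
    leg  : ∀ i → CRingHom apex (obj i)
  open RingHomomorphism using (⟦_⟧)
  field
    commute : ∀ {i j} (f : Arrow i j) x →
              let open CommutativeRing (obj j) using (_≈_) in
              ⟦ mor f ⟧ (⟦ leg i ⟧ x) ≈ ⟦ leg j ⟧ x

module _ {D : Diagram c ℓ} where
  open Diagram D
  open RingHomomorphism using (⟦_⟧)

  IsConeMorphism : (K L : Cone D) → CRingHom (Cone.apex K) (Cone.apex L) → Set (c ⊔ ℓ)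
  IsConeMorphism K L h = ∀ i x →
    let open CommutativeRing (obj i) using (_≈_) in
    ⟦ Cone.leg L i ⟧ (⟦ h ⟧ x) ≈ ⟦ Cone.leg K i ⟧ x

  record IsLimit (L : Cone D) : Set (lsuc (c ⊔ ℓ)) where
    open CommutativeRing (Cone.apex L) using (_≈_)
    field
      mediate    : (K : Cone D) → CRingHom (Cone.apex K) (Cone.apex L)
      isMediator : (K : Cone D) → IsConeMorphism K L (mediate K)
      unique     : (K : Cone D) (h : CRingHom (Cone.apex K) (Cone.apex L)) →
                   IsConeMorphism K L h → ∀ x → ⟦ h ⟧ x ≈ ⟦ mediate K ⟧ x

record Limit (D : Diagram c ℓ) : Set (lsuc (c ⊔ ℓ)) where
  field
    cone    : Cone D
    isLimit : IsLimit cone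
  open Cone cone public
  open IsLimit isLimit public

record Ideal (R : CommutativeRing c ℓ) : Set (c ⊔ lsuc ℓ) where
  open CommutativeRing R
  field
    member   : Pred Carrier ℓ
    resp     : ∀ {x y} → x ≈ y → x ∈ member → y ∈ member
    0-closed : 0# ∈ member
    +-closed : ∀ {x y} → x ∈ member → y ∈ member → x + y ∈ member
    *-closed : ∀ r {x} → x ∈ member → r * x ∈ member

  neg-closed : ∀ {x} → x ∈ member → - x ∈ member
  neg-closed {x} p = resp (RingProperties.-1*x≈-x ring x) (*-closed (- 1#) p)

module _ (R : CommutativeRing c ℓ) where
  open CommutativeRing R
  open AbelianGroupProperties +-abelianGroup
    using (⁻¹-anti-homo‿-; ⁻¹-∙-comm)
  open CommutativeSemigroupProperties +-commutativeSemigroup using (interchange)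
  open RingProperties ring using (-‿distribʳ-*)
  open SetoidReasoning setoid

  private
    telescope : ∀ x y z → (x - y) + (y - z) ≈ x - z
    telescope x y z = begin
      (x - y) + (y - z)      ≈⟨ +-assoc x (- y) (y - z) ⟩
      x + (- y + (y - z))    ≈⟨ +-congˡ (+-assoc (- y) y (- z)) ⟨
      x + ((- y + y) - z)    ≈⟨ +-congˡ (+-congʳ (-‿inverseˡ y)) ⟩
      x + (0# - z)           ≈⟨ +-congˡ (+-identityˡ (- z)) ⟩
      x - z                  ∎

    sub-+ : ∀ x y u v → (x - y) + (u - v) ≈ (x + u) - (y + v)
    sub-+ x y u v = trans (interchange x (- y) u (- v)) (+-congˡ (⁻¹-∙-comm y v))

    sub-neg : ∀ x y → - (x - y) ≈ - x - - y
    sub-neg x y = sym (⁻¹-∙-comm x (- y))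

    *-sub : ∀ r x y → r * (x - y) ≈ r * x - r * y
    *-sub r x y = trans (distribˡ r x (- y)) (+-congˡ (sym (-‿distribʳ-* r y)))

    sub-* : ∀ x y u v → u * (x - y) + y * (u - v) ≈ x * u - y * v
    sub-* x y u v = begin
      u * (x - y) + y * (u - v)              ≈⟨ +-cong (*-sub u x y) (*-sub y u v) ⟩
      (u * x - u * y) + (y * u - y * v)      ≈⟨ +-congʳ (+-cong (*-comm u x) (-‿cong (*-comm u y))) ⟩
      (x * u - y * u) + (y * u - y * v)      ≈⟨ telescope (x * u) (y * u) (y * v) ⟩
      x * u - y * v                          ∎

  -- The carrier stays the same and only the equality is coarsened.
  quotientRing : Ideal R → CommutativeRing c ℓ
  quotientRing I = record
    { Carrier = Carrier
    ; _≈_     = _≈ᵢ_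
    ; _+_     = _+_
    ; _*_     = _*_
    ; -_      = -_
    ; 0#      = 0#
    ; 1#      = 1#
    ; isCommutativeRing = record
      { isRing = record
        { +-isAbelianGroup = record
          { isGroup = record
            { isMonoid = record
              { isSemigroup = record
                { isMagma = record
                  { isEquivalence = record
                    { refl  = lift refl
                    ; sym   = λ {x} {y} p → resp (⁻¹-anti-homo‿- x y) (neg-closed p)
                    ; trans = λ {x} {y} {z} p q → resp (telescope x y z) (+-closed p q)
                    }
                  ; ∙-cong = λ {x} {y} {u} {v} p q → resp (sub-+ x y u v) (+-closed p q)
                  }
                ; assoc = λ x y z → lift (+-assoc x y z)
                }
              ; identity = (λ x → lift (+-identityˡ x)) , (λ x → lift (+-identityʳ x))
              }
            ; inverse = (λ x → lift (-‿inverseˡ x)) , (λ x → lift (-‿inverseʳ x))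
            ; ⁻¹-cong = λ {x} {y} p → resp (sub-neg x y) (neg-closed p)
            }
          ; comm = λ x y → lift (+-comm x y)
          }
        ; *-cong     = λ {x} {y} {u} {v} p q →
                         resp (sub-* x y u v) (+-closed (*-closed u p) (*-closed y q))
        ; *-assoc    = λ x y z → lift (*-assoc x y z)
        ; *-identity = (λ x → lift (*-identityˡ x)) , (λ x → lift (*-identityʳ x))
        ; distrib    = (λ x y z → lift (distribˡ x y z)) , (λ x y z → lift (distribʳ x y z))
        }
      ; *-comm = λ x y → lift (*-comm x y)
      }
    }
    where
    open Ideal I
    _≈ᵢ_ : Rel Carrier ℓ
    x ≈ᵢ y = x - y ∈ member

    lift : ∀ {x y} → x ≈ y → x ≈ᵢ y
    lift {x} {y} p = resp (sym (trans (+-congʳ p) (-‿inverseʳ y))) 0-closed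

  quotientMap : (I : Ideal R) → CRingHom R (quotientRing I)
  quotientMap I = record
    { ⟦_⟧ = λ x → x
    ; isRingHomomorphism = record
      { isSemiringHomomorphism = record
        { isNearSemiringHomomorphism = record
          { +-isMonoidHomomorphism = record
            { isMagmaHomomorphism = record
              { isRelHomomorphism = record
                { cong = λ {x} {y} p →
                    resp (sym (trans (+-congʳ p) (-‿inverseʳ y))) 0-closed }
              ; homo = λ _ _ → Q.refl
              }
            ; ε-homo = Q.refl
            }
          ; *-homo = λ _ _ → Q.refl
          }
        ; 1#-homo = Q.refl
        }
      ; -‿homo = λ _ → Q.refl
      }
    }
    where
    open Ideal I
    module Q = CommutativeRing (quotientRing I)

  -- The graph is undirected and may have parallel edges and loops.  The order
  -- of the pair `ends e` is an arbitrary choice: both the spline condition and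
  -- the spline diagram are symmetric in the two ends.
  record EdgeLabeledGraph : Set (c ⊔ lsuc ℓ) where
    field
      #vertices : ℕ
      #edges    : ℕ
      ends      : Fin #edges → Fin #vertices × Fin #vertices
      label     : Fin #edges → Ideal R

    Vertex Edge : Set
    Vertex = Fin #vertices
    Edge   = Fin #edges

    end₁ end₂ : Edge → Vertex
    end₁ e = proj₁ (ends e)
    end₂ e = proj₂ (ends e)

  module _ (G : EdgeLabeledGraph) where
    open EdgeLabeledGraph G
    open Ideal using (member; resp; 0-closed)

    IsSpline : (Vertex → Carrier) → Set ℓ
    IsSpline s = ∀ e → s (end₁ e) - s (end₂ e) ∈ member (label e)

    Spline : Set (c ⊔ ℓ)
    Spline = Σ[ s ∈ (Vertex → Carrier) ] IsSpline s

    private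
      const-isSpline : ∀ x → IsSpline (λ _ → x)
      const-isSpline x e = resp (label e) (sym (-‿inverseʳ x)) (0-closed (label e))

    splineRawRing : RawRing (c ⊔ ℓ) ℓ
    splineRawRing = record
      { Carrier = Spline
      ; _≈_ = λ (s , _) (t , _) → ∀ v → s v ≈ t v
      ; _+_ = λ (s , p) (t , q) → (λ v → s v + t v) , λ e →
          let module Q = CommutativeRing (quotientRing (label e)) in Q.+-cong (p e) (q e)
      ; _*_ = λ (s , p) (t , q) → (λ v → s v * t v) , λ e →
          let module Q = CommutativeRing (quotientRing (label e)) in Q.*-cong (p e) (q e)
      ; -_  = λ (s , p) → (λ v → - s v) , λ e →
          let module Q = CommutativeRing (quotientRing (label e)) in Q.-‿cong (p e)
      ; 0#  = (λ _ → 0#) , const-isSpline 0#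
      ; 1#  = (λ _ → 1#) , const-isSpline 1#
      }

    private
      functions : CommutativeRing c ℓ
      functions = Pointwise.commutativeRing Vertex R

      inclusion-isRingMonomorphism :
        IsRingMonomorphism splineRawRing (CommutativeRing.rawRing functions) proj₁
      inclusion-isRingMonomorphism = record
        { isRingHomomorphism = record
          { isSemiringHomomorphism = record
            { isNearSemiringHomomorphism = record
              { +-isMonoidHomomorphism = record
                { isMagmaHomomorphism = record
                  { isRelHomomorphism = record { cong = λ p → p }
                  ; homo = λ _ _ _ → refl
                  }
                ; ε-homo = λ _ → refl
                }
              ; *-homo = λ _ _ _ → refl
              }
            ; 1#-homo = λ _ → refl
            }
          ; -‿homo = λ _ _ → refl
          }
        ; injective = λ p → p
        }

    splineRing : CommutativeRing (c ⊔ ℓ) ℓ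
    splineRing = record
      { isCommutativeRing =
          RingMonomorphism.isCommutativeRing inclusion-isRingMonomorphism
            (CommutativeRing.isCommutativeRing functions)
      }

    data SplineNode : Set where
      vertex : Vertex → SplineNode
      edge   : Edge → SplineNode

    data SplineArrow : SplineNode → SplineNode → Set where
      from₁ : ∀ e → SplineArrow (vertex (end₁ e)) (edge e)
      from₂ : ∀ e → SplineArrow (vertex (end₂ e)) (edge e)

    private
      splineObj : SplineNode → CommutativeRing c ℓ
      splineObj (vertex _) = R
      splineObj (edge e)   = quotientRing (label e)

      splineMor : ∀ {i j} → SplineArrow i j → CRingHom (splineObj i) (splineObj j)
      splineMor (from₁ e) = quotientMap (label e)
      splineMor (from₂ e) = quotientMap (label e)

    splineDiagram : Diagram c ℓ
    splineDiagram = record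
      { Node  = SplineNode
      ; Arrow = SplineArrow
      ; obj   = splineObj
      ; mor   = splineMor
      }

{-# OPTIONS --safe #-}
-- The ring of splines, with evaluation at the vertices as legs, is itself a
-- limit of the spline diagram: the two arrows into R / I_uv force the legs of any
-- cone at u and v to agree modulo I_uv, so the vertex legs assemble into a spline.
-- Limits being unique up to isomorphism, it is isomorphic to any other limit.
module Submission where

open import Defs
open import Algebra.Bundles using (CommutativeRing)
import Algebra.Morphism.Construct.Composition as Composition
import Algebra.Morphism.Construct.Identity as Identity
open import Algebra.Morphism.Bundles using (RingHomomorphism)
open import Data.Product.Base using (_×_; _,_; proj₁)
open import Level using (Level; _⊔_)

private
  variable
    a b c ℓ ℓ₁ ℓ₂ ℓ₃ : Level

open RingHomomorphism using (⟦_⟧; isRingHomomorphism; ⟦⟧-cong)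

idHom : (A : CommutativeRing a ℓ) → CRingHom A A
idHom A = record
  { isRingHomomorphism = Identity.isRingHomomorphism rawRing refl }
  where open CommutativeRing A

composeHom : (A : CommutativeRing a ℓ₁) (B : CommutativeRing b ℓ₂) (C : CommutativeRing c ℓ₃) →
             CRingHom B C → CRingHom A B → CRingHom A C
composeHom A B C g f = record
  { isRingHomomorphism = Composition.isRingHomomorphism (CommutativeRing.trans C)
      (isRingHomomorphism f) (isRingHomomorphism g) }

module _ {D : Diagram c ℓ} where
  open Diagram D

  -- The round trip and the identity are both cone morphisms from the cone of `L` to itself, so
  -- uniqueness equates each with the same mediator.
  mediate-inverse : (L M : Limit D) → ∀ x →
    let open CommutativeRing (Limit.apex L) using (_≈_) in
    ⟦ Limit.mediate L (Limit.cone M) ⟧ (⟦ Limit.mediate M (Limit.cone L) ⟧ x) ≈ x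
  mediate-inverse L M x = trans
    (L.unique L.cone (composeHom L.apex M.apex L.apex g f)
      (λ i y → CommutativeRing.trans (obj i)
        (L.isMediator M.cone i (⟦ f ⟧ y)) (M.isMediator L.cone i y)) x)
    (sym (L.unique L.cone (idHom L.apex) (λ i _ → CommutativeRing.refl (obj i)) x))
    where
    module L = Limit L
    module M = Limit M
    open CommutativeRing L.apex using (sym; trans)
    f = M.mediate L.cone
    g = L.mediate M.cone

  -- The two mediators are mutually inverse: the composite on the apex of `L` gives injectivity, the
  -- one on the apex of `M` gives surjectivity.
  limit-unique : (L M : Limit D) → Limit.apex L ≅ Limit.apex M
  limit-unique L M = ⟦ f ⟧ , record
    { isRingMonomorphism = record
      { isRingHomomorphism = isRingHomomorphism f
      ; injective = λ {x} {y} fx≈fy →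
          trans (sym (mediate-inverse L M x)) (trans (⟦⟧-cong g fx≈fy) (mediate-inverse L M y))
      }
    ; surjective = λ y → ⟦ g ⟧ y , λ z≈gy →
        CommutativeRing.trans (Limit.apex M) (⟦⟧-cong f z≈gy) (mediate-inverse M L y)
    }
    where
    open CommutativeRing (Limit.apex L) using (sym; trans)
    f = Limit.mediate M (Limit.cone L)
    g = Limit.mediate L (Limit.cone M)

-- A spline carries membership proofs at level `ℓ`. With the carrier of `R` at `c ⊔ ℓ`, the spline
-- ring has the same levels as `R` and can be the apex of a cone.
module _ (R : CommutativeRing (c ⊔ ℓ) ℓ) (G : EdgeLabeledGraph R) where
  open CommutativeRing R using (refl)
  open EdgeLabeledGraph G

  private
    D = splineDiagram R G
    S = splineRing R G
    module Q e = CommutativeRing (quotientRing R (label e))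

  evaluation : Vertex → CRingHom S R
  evaluation v = record
    { ⟦_⟧ = λ s → proj₁ s v
    ; isRingHomomorphism = record
      { isSemiringHomomorphism = record
        { isNearSemiringHomomorphism = record
          { +-isMonoidHomomorphism = record
            { isMagmaHomomorphism = record
              { isRelHomomorphism = record { cong = λ s≈t → s≈t v }
              ; homo = λ _ _ → refl
              }
            ; ε-homo = refl
            }
          ; *-homo = λ _ _ → refl
          }
        ; 1#-homo = refl
        }
      ; -‿homo = λ _ → refl
      }
    }

  splineCone : Cone D
  splineCone = record
    { apex    = S
    ; leg     = λ where
        (vertex v) → evaluation v
        -- Going through the first end is a choice; it makes the triangle for `from₁` hold by
        -- reflexivity.
        (edge e)   → composeHom S R (quotientRing R (label e))
                       (quotientMap R (label e)) (evaluation (end₁ e))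
    ; commute = λ where
        (from₁ e) _       → Q.refl e
        -- The spline condition at `e` is, by definition, equality of the two end values in the
        -- quotient.
        (from₂ e) (_ , p) → Q.sym e (p e)
    }

  coneMap : (K : Cone D) → CRingHom (Cone.apex K) S
  coneMap K = record
    { ⟦_⟧ = λ x → (λ v → ⟦ leg (vertex v) ⟧ x) , λ e →
        -- Both vertex legs agree in the quotient with the edge leg at `e`, hence with each other.
        Q.trans e (commute (from₁ e) x) (Q.sym e (commute (from₂ e) x))
    ; isRingHomomorphism = record
      { isSemiringHomomorphism = record
        { isNearSemiringHomomorphism = record
          { +-isMonoidHomomorphism = record
            { isMagmaHomomorphism = record
              { isRelHomomorphism = record { cong = λ x≈y v → ⟦⟧-cong (leg (vertex v)) x≈y }
              ; homo = λ x y v → H.+-homo v x y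
              }
            ; ε-homo = λ v → H.0#-homo v
            }
          ; *-homo = λ x y v → H.*-homo v x y
          }
        ; 1#-homo = λ v → H.1#-homo v
        }
      ; -‿homo = λ x v → H.-‿homo v x
      }
    }
    where
    open Cone K
    module H v = RingHomomorphism (leg (vertex v))

  splineLimit : Limit D
  splineLimit = record
    { cone    = splineCone
    ; isLimit = record
      { mediate    = coneMap
      ; isMediator = λ K → λ where
          (vertex _) _ → refl
          (edge e)   x → Cone.commute K (from₁ e) x
      -- Equality of splines is pointwise, so the vertex legs alone determine `h`.
      ; unique     = λ _ _ h-commutes x v → h-commutes (vertex v) x
      }
    }

theorem1 : ∀ {c ℓ : Level} (R : CommutativeRing (c ⊔ ℓ) ℓ) (G : EdgeLabeledGraph R) →
    Limit (splineDiagram R G) ×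
    ((L : Limit (splineDiagram R G)) → splineRing R G ≅ Limit.apex L)
theorem1 {c} {ℓ} R G = splineLimit {c} {ℓ} R G , limit-unique (splineLimit {c} {ℓ} R G)
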